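{- Let $G$ be a locally bipartite graph which contains $H_0$ as a subgraph. If $\delta(G) > \frac{8}{15}|G|$, then $G$ contains $H_2$ as a subgraph.
   Context: Graphs are finite and simple; $|G|$ is the number of vertices, $\delta(G)$ the minimum degree. A graph is locally bipartite if the neighbourhood of every vertex induces a bipartite graph. $H_0$ has vertices $a_0,\dots,a_6$ and edges $a_ia_{i+1}$ ($i$ mod 7) together with $a_0a_2$, $a_0a_5$, $a_1a_3$, $a_4a_6$. $H_2$ has vertices $a_0,\dots,a_6$ and edges $a_ia_{i+1}$ ($i$ mod 7) together with $a_1a_3$, $a_3a_5$, $a_5a_0$, $a_0a_2$, $a_2a_4$, $a_4a_6$ (i.e. the square of the 7-cycle minus the edge $a_6a_1$). -}

module Defs where

open import Data.Nat using (ℕ; _*_; _>_)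
open import Data.Fin using (Fin; zero; suc)
open import Data.Bool using (Bool; true; false; T; _≟_)
open import Data.List using (List; length; filter; allFin)
open import Data.Product using (Σ; _×_; ∃)
open import Function.Definitions using (Injective)
open import Relation.Binary.PropositionalEquality using (_≡_)
open import Relation.Nullary using (¬_)
open import Relation.Nullary.Decidable using (does)
open import Data.Bool using (T?)
import Data.Bool
import Data.Bool.Properties

record Graph (n : ℕ) : Set where
  field
    adj   : Fin n → Fin n → Bool
    sym   : ∀ u v → adj u v ≡ adj v u
    irrefl : ∀ v → adj v v ≡ false
open Graph public

order : ∀ {n} → Graph n → ℕ
order {n} _ = n

degree : ∀ {n} → Graph n → Fin n → ℕ
degree {n} G v = length (filter (λ u → T? (adj G v u)) (allFin n))

-- δ(G) > (8/15)|G|, written without division: 15 · deg v > 8 · |G| for every v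
-- (this is equivalent to the minimum degree exceeding 8|G|/15)
MinDegreeAbove8/15 : ∀ {n} → Graph n → Set
MinDegreeAbove8/15 {n} G = ∀ v → 15 * degree G v > 8 * n

LocallyBipartite : ∀ {n} → Graph n → Set
LocallyBipartite {n} G =
  ∀ v → Σ (Fin n → Bool) λ c →
    ∀ x y → T (adj G v x) → T (adj G v y) → T (adj G x y) → ¬ (c x ≡ c y)

_⊆ᵍ_ : ∀ {m n} → Graph m → Graph n → Set
_⊆ᵍ_ {m} {n} H G =
  Σ (Fin m → Fin n) λ f → Injective _≡_ _≡_ f ×
    (∀ x y → T (adj H x y) → T (adj G (f x) (f y)))

pattern a0 = zero
pattern a1 = suc zero
pattern a2 = suc (suc zero)
pattern a3 = suc (suc (suc zero))
pattern a4 = suc (suc (suc (suc zero)))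
pattern a5 = suc (suc (suc (suc (suc zero))))
pattern a6 = suc (suc (suc (suc (suc (suc zero)))))

h0e : Fin 7 → Fin 7 → Bool
h0e a0 a1 = true
h0e a1 a2 = true
h0e a2 a3 = true
h0e a3 a4 = true
h0e a4 a5 = true
h0e a5 a6 = true
h0e a6 a0 = true
h0e a0 a2 = true
h0e a0 a5 = true
h0e a1 a3 = true
h0e a4 a6 = true
h0e _  _  = false

h2e : Fin 7 → Fin 7 → Bool
h2e a0 a1 = true
h2e a1 a2 = true
h2e a2 a3 = true
h2e a3 a4 = true
h2e a4 a5 = true
h2e a5 a6 = true
h2e a6 a0 = true
h2e a1 a3 = true
h2e a3 a5 = true
h2e a5 a0 = true
h2e a0 a2 = true
h2e a2 a4 = true
h2e a4 a6 = true
h2e _  _  = false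

symAdj : (Fin 7 → Fin 7 → Bool) → Fin 7 → Fin 7 → Bool
symAdj e x y = e x y Data.Bool.∨ e y x

H0 : Graph 7
H0 = record
  { adj = symAdj h0e
  ; sym = λ x y → Data.Bool.Properties.∨-comm (h0e x y) (h0e y x)
  ; irrefl = λ { a0 → _≡_.refl ; a1 → _≡_.refl ; a2 → _≡_.refl ; a3 → _≡_.refl
               ; a4 → _≡_.refl ; a5 → _≡_.refl ; a6 → _≡_.refl } }

H2 : Graph 7
H2 = record
  { adj = symAdj h2e
  ; sym = λ x y → Data.Bool.Properties.∨-comm (h2e x y) (h2e y x)
  ; irrefl = λ { a0 → _≡_.refl ; a1 → _≡_.refl ; a2 → _≡_.refl ; a3 → _≡_.refl
               ; a4 → _≡_.refl ; a5 → _≡_.refl ; a6 → _≡_.refl } }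

{-# OPTIONS --safe #-}
-- Only homomorphisms matter: identifying two vertices of H₂ creates a loop or an odd wheel, so every
-- homomorphism from H₂ to a locally bipartite graph is injective. Likewise, since the 5-wheel maps
-- onto K₄, the only consequence of local bipartiteness that is needed is that there is no
-- homomorphism from the 5-wheel.
--
-- If weights w are put on the vertices of a configuration in G, then double counting yields a vertex
-- x whose neighbours in the configuration have more than 8/15 of the total weight. For suitable w,
-- every possible neighbourhood of x completes either a 5-wheel or a configuration closer to H₂. This
-- leads from H₀ to H₀ + a₂a₄ or H₀ + a₂a₅, from H₀ + a₂a₅ to H₀ + a₂a₄, and from H₀ + a₂a₄ to H₂.
module Submission where

open import Defs
import Algebra.Properties.Semiring.Sum
open import Data.Bool using (Bool; true; false; T; T?; not; if_then_else_; _∨_)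
open import Data.Bool.Properties using (T-∨; ¬-not; not-¬; not-involutive)
open import Data.Fin using (Fin; zero; suc; _≟_)
open import Data.Fin.Permutation.Components using (transpose)
open import Data.Fin.Properties using (any?; all?)
open import Data.List using (List; []; _∷_; length; filter; tabulate)
open import Data.List.Relation.Unary.Any as Any using (Any; here; there)
open import Data.Nat using (ℕ; zero; suc; _+_; _*_; _≤_; _<_; _≤?_; _<?_; NonZero)
open import Data.Nat.Properties hiding (_≟_; _≤?_; _<?_)
open import Data.Product using (∃; _,_)
open import Data.Sum using (_⊎_; inj₁; inj₂; [_,_]′)
open import Data.Vec as Vec using (Vec; []; _∷_; lookup)
open import Data.Vec.Properties using (lookup∘tabulate)
open import Function using (_∘_; id; case_of_; Equivalence)
open import Function.Definitions using (Injective)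
open import Relation.Binary.PropositionalEquality
  using (_≡_; refl; cong; subst; subst₂; module ≡-Reasoning) renaming (sym to ≡-sym)
open import Relation.Nullary using (Dec; yes; no; ¬_; contradiction)
open import Relation.Nullary.Decidable using (map′; _×-dec_; _⊎-dec_; _→-dec_; from-yes; decidable-stable)
open import Relation.Unary using (Decidable)

open Algebra.Properties.Semiring.Sum +-*-semiring
  using (sum; sum-cong-≗; ∑-comm; *-distribˡ-sum; *-distribʳ-sum)

private variable
  k m n : ℕ

-- Homomorphisms

Rel : ℕ → Set
Rel n = Fin n → Fin n → Bool

Preserves : Rel m → Rel n → (Fin m → Fin n) → Set
Preserves A B f = ∀ i j → T (A i j) → T (B (f i) (f j))

_⟶_ : Rel m → Rel n → Set
A ⟶ B = ∃ (Preserves A B)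

preserves? : (A : Rel m) (B : Rel n) → Decidable (Preserves A B)
preserves? A B f = all? λ i → all? λ j → T? (A i j) →-dec T? (B (f i) (f j))

⟶-trans : {A : Rel k} {B : Rel m} {C : Rel n} → A ⟶ B → B ⟶ C → A ⟶ C
⟶-trans (f , p) (g , q) = g ∘ f , λ i j → q (f i) (f j) ∘ p i j

T-adj-sym : (G : Graph n) → ∀ u v → T (adj G u v) → T (adj G v u)
T-adj-sym G u v = subst T (sym G u v)

symAdj-preserves : (G : Graph n) {A : Rel 7} {f : Fin 7 → Fin n} →
  Preserves A (adj G) f → Preserves (symAdj A) (adj G) f
symAdj-preserves G {A} {f} p i j =
  [ p i j , T-adj-sym G (f j) (f i) ∘ p j i ]′ ∘ Equivalence.to T-∨

-- A vertex with heavy neighbourhood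

⟦_⟧ : Bool → ℕ
⟦ b ⟧ = if b then 1 else 0

length-filter-tabulate : ∀ {A : Set} (p : A → Bool) (f : Fin n → A) →
  length (filter (T? ∘ p) (tabulate f)) ≡ sum (⟦_⟧ ∘ p ∘ f)
length-filter-tabulate {n = zero} p f = refl
length-filter-tabulate {n = suc n} p f with p (f zero)
... | true  = cong suc (length-filter-tabulate p (f ∘ suc))
... | false = length-filter-tabulate p (f ∘ suc)

degree-sum : (G : Graph n) → ∀ v → degree G v ≡ sum λ u → ⟦ adj G v u ⟧
degree-sum G v = length-filter-tabulate (adj G v) id

sum-mono-≤ : {f g : Fin n → ℕ} → (∀ i → f i ≤ g i) → sum f ≤ sum g
sum-mono-≤ {n = zero}  f≤g = ≤-refl
sum-mono-≤ {n = suc n} f≤g = +-mono-≤ (f≤g zero) (sum-mono-≤ (f≤g ∘ suc))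

sum-const : ∀ n c → sum {n} (λ _ → c) ≡ n * c
sum-const zero    c = refl
sum-const (suc n) c = cong (c +_) (sum-const n c)

weight : (Fin m → ℕ) → (Fin m → Bool) → ℕ
weight w S = sum λ i → w i * ⟦ S i ⟧

sum-weight : (G : Graph n) (w : Fin m → ℕ) (f : Fin m → Fin n) →
  sum (λ x → weight w λ i → adj G (f i) x) ≡ sum λ i → w i * degree G (f i)
sum-weight {n} {m} G w f = begin
  sum (λ x → sum λ i → w i * ⟦ adj G (f i) x ⟧)
    ≡⟨ ∑-comm {n} {m} (λ x i → w i * ⟦ adj G (f i) x ⟧) ⟩
  sum (λ i → sum λ x → w i * ⟦ adj G (f i) x ⟧)
    ≡⟨ sum-cong-≗ {m} (λ i → *-distribˡ-sum (w i) (λ x → ⟦ adj G (f i) x ⟧)) ⟨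
  sum (λ i → w i * sum λ x → ⟦ adj G (f i) x ⟧)
    ≡⟨ sum-cong-≗ {m} (λ i → cong (w i *_) (degree-sum G (f i))) ⟨
  sum (λ i → w i * degree G (f i)) ∎
  where open ≡-Reasoning

-- By double counting, the weighted counts `h x` add up to the weighted sum of the degrees, so not
-- all of them can be light.
heavy-vertex : (G : Graph n) → MinDegreeAbove8/15 G →
  (w : Fin m → ℕ) → .{{NonZero (sum w)}} → (f : Fin m → Fin n) →
  ∃ λ x → 8 * sum w < 15 * weight w λ i → adj G (f i) x
heavy-vertex {n} {m} G δ w f = decidable-stable (any? λ x → 8 * W <? 15 * h x) λ light →
  <-irrefl refl (begin-strict
    -- The strict bound in `δ` unfolds to `suc (8 * n)` on the left. Single weights may be zero, so
    -- strictness comes from the total `W` being nonzero.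
    W * (8 * n)                           <⟨ *-monoʳ-< W (n<1+n (8 * n)) ⟩
    W * suc (8 * n)                       ≡⟨ *-distribʳ-sum (suc (8 * n)) w ⟩
    sum (λ i → w i * suc (8 * n))         ≤⟨ sum-mono-≤ (λ i → *-monoʳ-≤ (w i) (δ (f i))) ⟩
    sum (λ i → w i * (15 * d i))          ≡⟨ sum-cong-≗ {m} (λ i → x∙yz≈y∙xz (w i) 15 (d i)) ⟩
    sum (λ i → 15 * (w i * d i))          ≡⟨ *-distribˡ-sum 15 (λ i → w i * d i) ⟨
    15 * sum (λ i → w i * d i)            ≡⟨ cong (15 *_) (sum-weight G w f) ⟨
    15 * sum h                            ≡⟨ *-distribˡ-sum 15 h ⟩
    sum (λ x → 15 * h x)                  ≤⟨ sum-mono-≤ (λ x → ≮⇒≥ (light ∘ (x ,_))) ⟩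
    sum {n} (λ _ → 8 * W)                 ≡⟨ sum-const n (8 * W) ⟩
    n * (8 * W)                           ≡⟨ x∙yz≈z∙yx n 8 W ⟩
    W * (8 * n)                           ∎)
  where
  open ≤-Reasoning
  open import Algebra.Properties.CommutativeSemigroup *-commutativeSemigroup
    using (x∙yz≈y∙xz; x∙yz≈z∙yx)
  W = sum w
  d : Fin m → ℕ
  d i = degree G (f i)
  h : Fin n → ℕ
  h x = weight w λ i → adj G (f i) x

-- Extending a configuration by a heavy vertex

-- `S` is a vector so that `allVec?` can run through all neighbourhoods without function
-- extensionality.
extend : Rel m → Vec Bool m → Rel (suc m)
extend A S zero    zero    = false
extend A S zero    (suc j) = lookup S j
extend A S (suc i) zero    = lookup S i
extend A S (suc i) (suc j) = A i j

extend-⟶ : (G : Graph n) {A : Rel m} {f : Fin m → Fin n} → Preserves A (adj G) f →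
  ∀ x → extend A (Vec.tabulate λ i → adj G (f i) x) ⟶ adj G
extend-⟶ {n} {m} G {A} {f} p x = f⁺ , p⁺
  where
  S = Vec.tabulate λ i → adj G (f i) x
  f⁺ : Fin (suc m) → Fin n
  f⁺ zero    = x
  f⁺ (suc i) = f i
  S⇒adj : ∀ i → T (lookup S i) → T (adj G (f i) x)
  S⇒adj i = subst T (lookup∘tabulate (λ i → adj G (f i) x) i)
  p⁺ : Preserves (extend A S) (adj G) f⁺
  p⁺ zero    (suc j) = T-adj-sym G (f j) x ∘ S⇒adj j
  p⁺ (suc i) zero    = S⇒adj i
  p⁺ (suc i) (suc j) = p i j

-- A certificate: some of the maps must be homomorphisms from the shape to the extended configuration.
record Target (m : ℕ) : Set where
  constructor _via_
  field
    {size} : ℕ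
    shape : Rel size
    maps  : List (Vec (Fin (suc m)) size)
open Target

Reaches : Rel (suc m) → Target m → Set
Reaches B t = Any (λ g → Preserves (shape t) B (lookup g)) (maps t)

Covered : Rel m → (Fin m → ℕ) → List (Target m) → Vec Bool m → Set
Covered A w ts S = 15 * weight w (lookup S) ≤ 8 * sum w ⊎ Any (Reaches (extend A S)) ts

covered? : (A : Rel m) (w : Fin m → ℕ) (ts : List (Target m)) → Decidable (Covered A w ts)
covered? A w ts S = (15 * weight w (lookup S) ≤? 8 * sum w)
  ⊎-dec Any.any? (λ t → Any.any? (λ g → preserves? (shape t) (extend A S) (lookup g)) (maps t)) ts

allVec? : {P : Vec Bool n → Set} → Decidable P → Dec (∀ S → P S)
allVec? {n = zero}  P? = map′ (λ { p [] → p }) (λ p → p []) (P? [])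
allVec? {n = suc n} P? =
  map′ (λ { (p , q) (true ∷ S) → p S ; (p , q) (false ∷ S) → q S })
       (λ p → (λ S → p (true ∷ S)) , λ S → p (false ∷ S))
       (allVec? (P? ∘ (true ∷_)) ×-dec allVec? (P? ∘ (false ∷_)))

-- The first alternative of `Covered` contradicts `heavy-vertex`, and the second composes with
-- `extend-⟶`. This reduces each step in `G` to a finite check on `A`.
reach : (G : Graph n) → MinDegreeAbove8/15 G → {A : Rel m} (w : Fin m → ℕ) → .{{NonZero (sum w)}} →
  (ts : List (Target m)) → (∀ S → Covered A w ts S) → A ⟶ adj G →
  Any (λ t → shape t ⟶ adj G) ts
reach {n} {m} G δ {A} w ts cover (f , p) = from-heavy (heavy-vertex G δ w f)
  where
  nbhd : Fin n → Fin m → Bool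
  nbhd x i = adj G (f i) x

  weight-tabulate : ∀ x → weight w (nbhd x) ≡ weight w (lookup (Vec.tabulate (nbhd x)))
  weight-tabulate x = sum-cong-≗ {m} λ i → cong (λ b → w i * ⟦ b ⟧) (≡-sym (lookup∘tabulate (nbhd x) i))

  found : ∀ x {t} → Reaches (extend A (Vec.tabulate (nbhd x))) t → shape t ⟶ adj G
  found x r = let g , q = Any.satisfied r in
    ⟶-trans {B = extend A (Vec.tabulate (nbhd x))} {C = adj G}
      (lookup g , q) (extend-⟶ G p x)

  from-heavy : ∃ (λ x → 8 * sum w < 15 * weight w (nbhd x)) → Any (λ t → shape t ⟶ adj G) ts
  from-heavy (x , heavy) =
    [ (λ light → contradiction
        (<-≤-trans heavy (≤-trans (≤-reflexive (cong (15 *_) (weight-tabulate x))) light)) (<-irrefl refl))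
    , Any.map (found x)
    ]′ (cover (Vec.tabulate (nbhd x)))

-- Configurations

-- The hub is `a0`. One orientation per edge suffices, since the relations mapped into are
-- symmetric.
wheel : Rel 6
wheel a0 (suc _) = true
wheel a1 a2 = true
wheel a2 a3 = true
wheel a3 a4 = true
wheel a4 a5 = true
wheel a5 a1 = true
wheel _ _ = false

h0+a₂a₄ : Rel 7
h0+a₂a₄ a2 a4 = true
h0+a₂a₄ i j = h0e i j

h0+a₂a₅ : Rel 7
h0+a₂a₅ a2 a5 = true
h0+a₂a₅ i j = h0e i j

-- In an extension the new vertex x has index 0, so aᵢ becomes bᵢ.
pattern x  = zero
pattern b0 = suc a0
pattern b1 = suc a1
pattern b2 = suc a2
pattern b3 = suc a3
pattern b4 = suc a4
pattern b5 = suc a5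
pattern b6 = suc a6

pattern vec₆ u₀ u₁ u₂ u₃ u₄ u₅ = u₀ ∷ u₁ ∷ u₂ ∷ u₃ ∷ u₄ ∷ u₅ ∷ []
pattern vec₇ u₀ u₁ u₂ u₃ u₄ u₅ u₆ = u₀ ∷ u₁ ∷ u₂ ∷ u₃ ∷ u₄ ∷ u₅ ∷ u₆ ∷ []

-- The colours of the hub's neighbourhood alternate along the rim; five changes would give `f a1`
-- the opposite of its own colour.
no-wheel : (G : Graph n) → LocallyBipartite G → ¬ (wheel ⟶ adj G)
no-wheel G bip (f , p) with bip (f a0)
... | c , proper = not-¬ {c (f a1)} refl (begin
  c (f a1)                         ≡⟨ ≢⇒not a1 a2 _ ⟩
  not (c (f a2))                   ≡⟨ cong not (≢⇒not a2 a3 _) ⟩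
  not (not (c (f a3)))             ≡⟨ not-involutive _ ⟩
  c (f a3)                         ≡⟨ ≢⇒not a3 a4 _ ⟩
  not (c (f a4))                   ≡⟨ cong not (≢⇒not a4 a5 _) ⟩
  not (not (c (f a5)))             ≡⟨ not-involutive _ ⟩
  c (f a5)                         ≡⟨ ≢⇒not a5 a1 _ ⟩
  not (c (f a1))                   ∎)
  where
  open ≡-Reasoning
  ≢⇒not : ∀ (i j : Fin 6) {_ : T (wheel a0 i)} {_ : T (wheel a0 j)} → T (wheel i j) →
    c (f i) ≡ not (c (f j))
  ≢⇒not i j {hi} {hj} e = ¬-not (proper (f i) (f j) (p a0 i hi) (p a0 j hj) (p i j e))

-- Injectivity of homomorphisms from H₂

-- Models the quotient on the same vertex set: `u` and `v` become twins that share all their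
-- neighbours.
merge : Fin m → Fin m → Rel m → Rel m
merge u v A i j = (A i j ∨ A (σ i) j) ∨ (A i (σ j) ∨ A (σ i) (σ j))
  where σ = transpose u v

transpose-invariant : {f : Fin m → Fin n} {u v : Fin m} → f u ≡ f v →
  ∀ i → f (transpose u v i) ≡ f i
transpose-invariant {u = u} {v} fu≡fv i with i ≟ u
... | yes refl = ≡-sym fu≡fv
... | no _ with i ≟ v
...   | yes refl = fu≡fv
...   | no _ = refl

-- Swapping `u` and `v` does not change `f`, so all four disjuncts of `merge` lead to the same pair
-- in `B`.
merge-preserves : {A : Rel m} {B : Rel n} {f : Fin m → Fin n} {u v : Fin m} →
  Preserves A B f → f u ≡ f v → Preserves (merge u v A) B f
merge-preserves {A = A} {B} {f} {u} {v} p fu≡fv i j =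
  [ [ p i j , transport (inv i) refl ]′ ∘ Equivalence.to T-∨
  , [ transport refl (inv j) , transport (inv i) (inv j) ]′ ∘ Equivalence.to T-∨ ]′ ∘ Equivalence.to T-∨
  where
  inv = transpose-invariant {f = f} {u} {v} fu≡fv
  transport : ∀ {i j i′ j′} → f i′ ≡ f i → f j′ ≡ f j → T (A i′ j′) → T (B (f i) (f j))
  transport {i′ = i′} {j′} e e′ a = subst₂ (λ y z → T (B y z)) e e′ (p i′ j′ a)

-- The constant map is for adjacent u and v, whose identification creates a loop.
collapsed-wheels : Fin 7 → List (Vec (Fin 7) 6)
collapsed-wheels u =
  Vec.replicate 6 u ∷
  vec₆ a0 a2 a4 a5 a6 a4 ∷
  vec₆ a0 a1 a2 a1 a2 a3 ∷
  vec₆ a0 a1 a2 a1 a5 a6 ∷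
  vec₆ a1 a0 a2 a3 a4 a2 ∷
  vec₆ a2 a0 a1 a3 a4 a6 ∷
  vec₆ a2 a0 a1 a3 a4 a5 ∷ []

Collapses : Fin 7 → Fin 7 → Set
Collapses u v = Any (λ g → Preserves wheel (merge u v (symAdj h2e)) (lookup g)) (collapsed-wheels u)

identification-creates-wheel : ∀ u v → u ≡ v ⊎ Collapses u v
identification-creates-wheel = from-yes (all? λ u → all? λ v → (u ≟ v) ⊎-dec
  Any.any? (λ g → preserves? wheel (merge u v (symAdj h2e)) (lookup g)) (collapsed-wheels u))

H2-hom-injective : (G : Graph n) → LocallyBipartite G →
  {f : Fin 7 → Fin n} → Preserves (symAdj h2e) (adj G) f → Injective _≡_ _≡_ f
H2-hom-injective G bip {f} p {u} {v} fu≡fv =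
  [ id , (λ collapses → contradiction (wheel-from (Any.satisfied collapses)) (no-wheel G bip)) ]′
    (identification-creates-wheel u v)
  where
  wheel-from : ∃ (λ g → Preserves wheel (merge u v (symAdj h2e)) (lookup g)) → wheel ⟶ adj G
  wheel-from (g , q) = ⟶-trans {B = merge u v (symAdj h2e)} {C = adj G} (lookup g , q)
    (f , merge-preserves {A = symAdj h2e} {B = adj G} p fu≡fv)

embed-H2 : (G : Graph n) → LocallyBipartite G → h2e ⟶ adj G → H2 ⊆ᵍ G
embed-H2 G bip (g , q) = g , H2-hom-injective G bip q′ , q′
  where q′ = symAdj-preserves G {h2e} {g} q

-- Weights and finite case checks

-- The totals are 15, 4 and 15, so heavy means weight at least 9, 3 and 9. Each weighting is
-- invariant under the symmetries of its configuration.
w₂₄ w₂₅ w₀ : Fin 7 → ℕ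
w₂₄ = lookup (vec₇ 3 1 3 1 3 2 2)
w₂₅ = lookup (vec₇ 0 0 1 1 1 1 0)
w₀  = lookup (vec₇ 3 2 2 2 2 2 2)

targets₂₄ targets₂₅ targets₀ : List (Target 7)
targets₂₄ =
  (wheel via
    ( vec₆ b0 b5 b6 b5 b6 x
    ∷ vec₆ b0 b1 b2 b1 b2 x
    ∷ vec₆ b2 b1 b3 b4 x b3
    ∷ vec₆ b4 b5 b6 b5 b6 x
    ∷ vec₆ b2 b0 b1 b3 b4 x
    ∷ vec₆ b1 b0 b2 b3 x b2 ∷ [])) ∷
  (h2e via
    ( vec₇ b4 b3 b2 x b0 b5 b6
    ∷ vec₇ b4 b3 b2 b1 b0 x b5
    ∷ vec₇ b0 b1 b2 x b4 b5 b6
    ∷ vec₇ b0 b1 b2 b3 b4 x b5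
    ∷ vec₇ b4 b3 b2 x b0 b6 b5
    ∷ vec₇ b4 b3 b2 b1 b0 x b6
    ∷ vec₇ b0 b1 b2 x b4 b6 b5
    ∷ vec₇ b0 b1 b2 b3 b4 x b6 ∷ [])) ∷ []
targets₂₅ =
  (wheel via
    ( vec₆ b2 b0 b1 b3 x b5
    ∷ vec₆ b5 b0 b2 x b4 b6 ∷ [])) ∷
  (h0+a₂a₄ via
    ( vec₇ b2 b0 b5 b6 b4 b3 x
    ∷ vec₇ b3 b1 b2 b0 b5 b4 x ∷ [])) ∷ []
targets₀ =
  (wheel via
    ( vec₆ b0 b1 b2 b1 b2 x
    ∷ vec₆ b0 b5 b6 b5 b6 x
    ∷ vec₆ b1 b0 b2 b3 x b2
    ∷ vec₆ b4 b5 b6 b5 b6 x ∷ [])) ∷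
  (h0+a₂a₄ via
    ( vec₇ b0 b1 x b3 b4 b5 b6
    ∷ vec₇ b0 b2 x b3 b4 b5 b6
    ∷ vec₇ b0 b5 x b4 b3 b1 b2
    ∷ vec₇ b0 b6 x b4 b3 b1 b2 ∷ [])) ∷
  (h0+a₂a₅ via
    ( vec₇ b0 b1 x b3 b4 b5 b6
    ∷ vec₇ b0 b2 x b3 b4 b5 b6
    ∷ vec₇ b0 b2 b1 b3 b4 x b5
    ∷ vec₇ b0 b1 b2 b3 b4 x b5
    ∷ vec₇ b0 b1 x b3 b4 b6 b5
    ∷ vec₇ b0 b2 x b3 b4 b6 b5
    ∷ vec₇ b0 b2 b1 b3 b4 x b6
    ∷ vec₇ b0 b1 b2 b3 b4 x b6 ∷ [])) ∷ []

-- A triangle inside `S` gives a K₄ with `x`, and a0, a2, a4 in `S` make a2 the hub of a 5-wheel.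
-- Any other heavy `S` contains four vertices that let `x` act as a3 or a5 of H₂.
cover₂₄ : ∀ S → Covered (symAdj h0+a₂a₄) w₂₄ targets₂₄ S
cover₂₄ = from-yes (allVec? (covered? (symAdj h0+a₂a₄) w₂₄ targets₂₄))

-- A heavy `x` misses at most one vertex of the 4-cycle a2 a3 a4 a5. Without a4 or a3 there is a
-- 5-wheel with hub a2 or a5; without a5 or a2 there is a copy of `h0+a₂a₄`.
cover₂₅ : ∀ S → Covered (symAdj h0+a₂a₅) w₂₅ targets₂₅ S
cover₂₅ = from-yes (allVec? (covered? (symAdj h0+a₂a₅) w₂₅ targets₂₅))

-- H₀ is the Moser spindle with apex a0. If no triangle lies in `S`, then a heavy `S` contains a0,
-- since missing a0 and a vertex of each of a1a2a3 and a4a5a6 leaves at most 8. It also has at most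
-- one of a1, a2 and at most one of a5, a6. Both a3 and a4 in `S` then lead to `h0+a₂a₄`, exactly
-- one of them to `h0+a₂a₅`.
cover₀ : ∀ S → Covered (symAdj h0e) w₀ targets₀ S
cover₀ = from-yes (allVec? (covered? (symAdj h0e) w₀ targets₀))

-- From H₀ to H₂

module _ (G : Graph n) (bip : LocallyBipartite G) (δ : MinDegreeAbove8/15 G) where

  symmetrise : {A : Rel 7} → A ⟶ adj G → symAdj A ⟶ adj G
  symmetrise {A} (f , p) = f , symAdj-preserves G {A} p

  h0+a₂a₄⇒h2 : h0+a₂a₄ ⟶ adj G → h2e ⟶ adj G
  h0+a₂a₄⇒h2 h = case reach G δ w₂₄ targets₂₄ cover₂₄ (symmetrise h) of λ where
    (here h′)         → contradiction h′ (no-wheel G bip)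
    (there (here h′)) → h′

  h0+a₂a₅⇒h2 : h0+a₂a₅ ⟶ adj G → h2e ⟶ adj G
  h0+a₂a₅⇒h2 h = case reach G δ w₂₅ targets₂₅ cover₂₅ (symmetrise h) of λ where
    (here h′)         → contradiction h′ (no-wheel G bip)
    (there (here h′)) → h0+a₂a₄⇒h2 h′

  h0⇒h2 : symAdj h0e ⟶ adj G → h2e ⟶ adj G
  h0⇒h2 h = case reach G δ w₀ targets₀ cover₀ h of λ where
    (here h′)                 → contradiction h′ (no-wheel G bip)
    (there (here h′))         → h0+a₂a₄⇒h2 h′
    (there (there (here h′))) → h0+a₂a₅⇒h2 h′

theorem3p3 : ∀ {n : ℕ} (G : Graph n) → LocallyBipartite G → H0 ⊆ᵍ G →
    MinDegreeAbove8/15 G → H2 ⊆ᵍ G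
theorem3p3 G bip (f , _ , p) δ = embed-H2 G bip (h0⇒h2 G bip δ (f , p))
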